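{- Let $p$ be a prime number, and let $q\ge 0$ and $n\ge 1$ be integers. Then $$S_{p}^{(q)}(n)\equiv\binom{n+q+1}{q+2}\pmod p.$$
   Context: The hyper-sums of powers of integers are defined by $S_p^{(0)}(n)=S_p(n)=1^p+2^p+\cdots+n^p$ and $S_{p}^{(q)}(n)=\sum_{k=1}^{n}S_{p}^{(q-1)}(k)$ for $q\ge 1$. -}

module Defs where

open import Data.Integer as ℤ using (+_)
import Data.Integer.Divisibility as ℤ
open import Data.Nat using (ℕ; zero; suc; _+_; _^_)

-- f 1 + f 2 + ⋯ + f n; the sum starts at 1 and is empty for n = 0.
∑₁ : ℕ → (ℕ → ℕ) → ℕ
∑₁ zero    f = 0
∑₁ (suc n) f = ∑₁ n f + f (suc n)

powerSum : ℕ → ℕ → ℕ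
powerSum p n = ∑₁ n (λ k → k ^ p)

-- hyperSum p q n is S_p^{(q)}(n).
hyperSum : ℕ → ℕ → ℕ → ℕ
hyperSum p zero    n = powerSum p n
hyperSum p (suc q) n = ∑₁ n (λ k → hyperSum p q k)

-- The difference is taken in ℤ, since subtraction on ℕ truncates.
infix 4 _≡_[mod_]
_≡_[mod_] : ℕ → ℕ → ℕ → Set
a ≡ b [mod m ] = + m ℤ.∣ + a ℤ.- + b

{-# OPTIONS --safe #-}
-- By Fermat's little theorem k ^ p may be replaced by k = (k + 0) C 1, and the
-- hockey-stick identity then turns each of the q + 1 summations into one step
-- along a diagonal of Pascal's triangle.
module Submission where

open import Defs
open import Data.Nat using (ℕ; _+_; _≤_)
open import Data.Nat.Combinatorics using (_C_)
open import Data.Nat.Primality using (Prime)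
open import Algebra.Properties.CommutativeSemiring.Binomial using (binomialTerm; theorem)
open import Data.Fin using (zero; suc; toℕ; fromℕ; inject₁)
open import Data.Fin.Properties using (toℕ-fromℕ; toℕ-inject₁; toℕ<n)
import Data.Integer as ℤ
import Data.Integer.Divisibility.Signed as ℤ
import Data.Integer.Properties as ℤ
open import Data.Integer.Tactic.RingSolver using (solve-∀)
open import Data.Nat using (zero; suc; _*_; _^_; _∸_; _<_; _!; z<s; s<s)
open import Data.Nat.Combinatorics using (nCn≡1; nC1≡n; k>n⇒nCk≡0; nCk≡n!/k![n-k]!; k![n∸k]!∣n!;
  nCk+nC[k+1]≡[n+1]C[k+1])
open import Data.Nat.Divisibility using (_∣_; _∤_; _∣0; ∣1⇒≡1; ∣m⇒∣m*n; ∣m∣n⇒∣m+n; m∣m*n; >⇒∤)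
open import Data.Nat.DivMod using (m/n*n≡m)
open import Data.Nat.Primality using (euclidsLemma; ¬prime[0]; ¬prime[1])
open import Data.Nat.Properties
open import Data.Sum using ([_,_]′)
open import Data.Vec.Functional using (Vector; tail; init; last)
open import Function using (_∘_; id)
open import Relation.Binary.PropositionalEquality
open import Relation.Nullary using (contradiction)

open import Algebra.Properties.Monoid.Sum +-0-monoid using (sum; sum-init-last)
open import Algebra.Properties.Semiring.Exp +-*-semiring using () renaming (_^_ to _^ₛ_)
open import Algebra.Properties.Semiring.Mult +-*-semiring using () renaming (_×_ to _×ₛ_)

private
  variable
    a b c d m n k p : ℕ

mod-refl : a ≡ a [mod m ]
mod-refl {a} {m} = subst (λ i → m ∣ ℤ.∣ i ∣) (sym (ℤ.+-inverseʳ (ℤ.+ a))) (m ∣0)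

-- The relation is divisibility of an absolute value, which does not respect sums. Signed
-- divisibility does, so the differences are added there and telescope; each is named through `i`
-- because its absolute value does not determine it.
mod-trans : a ≡ b [mod m ] → b ≡ c [mod m ] → a ≡ c [mod m ]
mod-trans {a} {b} {m} {c} a≡b b≡c =
  ℤ.∣⇒∣ᵤ (subst (ℤ.+ m ℤ.∣_) (telescope (ℤ.+ a) (ℤ.+ b) (ℤ.+ c))
    (ℤ.∣m∣n⇒∣m+n (ℤ.∣ᵤ⇒∣ {i = ℤ.+ a ℤ.- ℤ.+ b} a≡b) (ℤ.∣ᵤ⇒∣ {i = ℤ.+ b ℤ.- ℤ.+ c} b≡c)))
  where
  telescope : ∀ x y z → (x ℤ.- y) ℤ.+ (y ℤ.- z) ≡ x ℤ.- z
  telescope = solve-∀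

mod-+-cong : a ≡ b [mod m ] → c ≡ d [mod m ] → a + c ≡ b + d [mod m ]
mod-+-cong {a} {b} {m} {c} {d} a≡b c≡d =
  ℤ.∣⇒∣ᵤ (subst (ℤ.+ m ℤ.∣_) (interchange (ℤ.+ a) (ℤ.+ b) (ℤ.+ c) (ℤ.+ d))
    (ℤ.∣m∣n⇒∣m+n (ℤ.∣ᵤ⇒∣ {i = ℤ.+ a ℤ.- ℤ.+ b} a≡b) (ℤ.∣ᵤ⇒∣ {i = ℤ.+ c ℤ.- ℤ.+ d} c≡d)))
  where
  interchange : ∀ x y z w → (x ℤ.- y) ℤ.+ (z ℤ.- w) ≡ (x ℤ.+ z) ℤ.- (y ℤ.+ w)
  interchange = solve-∀

∣⇒≡0[mod] : m ∣ a → a ≡ 0 [mod m ]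
-- `+ a - + 0` computes to `+ (a + 0)`.
∣⇒≡0[mod] {m} {a} = subst (m ∣_) (sym (+-identityʳ a))

∑₁-cong-mod : ∀ {f g} → (∀ k → f k ≡ g k [mod m ]) → ∀ n → ∑₁ n f ≡ ∑₁ n g [mod m ]
∑₁-cong-mod {m}         f≡g zero    = mod-refl {0} {m}
∑₁-cong-mod {m} {f} {g} f≡g (suc n) =
  mod-+-cong {∑₁ n f} {∑₁ n g} {m} {f (suc n)} {g (suc n)} (∑₁-cong-mod f≡g n) (f≡g (suc n))

-- Induction on `n` by Pascal's rule. The right side is the summand for `suc q` at `k = n`, so the
-- identity can be iterated.
∑₁-[k+q]C[1+q] : ∀ q n → ∑₁ n (λ k → (k + q) C suc q) ≡ (n + suc q) C suc (suc q)
∑₁-[k+q]C[1+q] q zero    = sym (k>n⇒nCk≡0 (n<1+n (suc q)))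
∑₁-[k+q]C[1+q] q (suc n) = begin
  ∑₁ n (λ k → (k + q) C suc q) + (suc n + q) C suc q        ≡⟨ cong (_+ (suc n + q) C suc q) (∑₁-[k+q]C[1+q] q n) ⟩
  (n + suc q) C suc (suc q) + (suc n + q) C suc q           ≡⟨ cong (λ i → (n + suc q) C suc (suc q) + i C suc q) (+-suc n q) ⟨
  (n + suc q) C suc (suc q) + (n + suc q) C suc q           ≡⟨ +-comm ((n + suc q) C suc (suc q)) _ ⟩
  (n + suc q) C suc q + (n + suc q) C suc (suc q)           ≡⟨ nCk+nC[k+1]≡[n+1]C[k+1] (n + suc q) (suc q) ⟩
  (suc n + suc q) C suc (suc q)                             ∎
  where open ≡-Reasoning

nCk*k![n∸k]!≡n! : k ≤ n → (n C k) * (k ! * (n ∸ k) !) ≡ n !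
nCk*k![n∸k]!≡n! {k} {n} k≤n =
  trans (cong (_* (k ! * (n ∸ k) !)) (nCk≡n!/k![n-k]! k≤n)) (m/n*n≡m (k![n∸k]!∣n! k≤n))
  where instance _ = k !* (n ∸ k) !≢0

-- By Euclid's lemma `p` would divide one of the factors of `k !`, all of which are positive and
-- below `p`.
prime∤k! : Prime p → k < p → p ∤ k !
prime∤k! {p} {zero}  pr k<p p∣1  = ¬prime[1] (subst Prime (∣1⇒≡1 p∣1) pr)
prime∤k! {p} {suc k} pr k<p p∣k! =
  [ >⇒∤ k<p , prime∤k! pr (<-trans (n<1+n k) k<p) ]′ (euclidsLemma (suc k) (k !) pr p∣k!)

-- `p` divides `p !`, the product of `p C k` with `k !` and `(p ∸ k) !`. Neither factorial is a
-- multiple of `p`: `k < p`, and `0 < k` gives `p ∸ k < p`.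
prime∣pCk : Prime p → 0 < k → k < p → p ∣ p C k
prime∣pCk {suc p} {k@(suc _)} pr 0<k k<p =
  [ id
  , (λ h → contradiction (euclidsLemma (k !) ((suc p ∸ k) !) pr h)
             [ prime∤k! pr k<p , prime∤k! pr (∸-monoʳ-< 0<k (<⇒≤ k<p)) ]′)
  ]′ (euclidsLemma (suc p C k) _ pr
       (subst (suc p ∣_) (sym (nCk*k![n∸k]!≡n! (<⇒≤ k<p))) (m∣m*n (p !))))

∣-sum : (t : Vector ℕ n) → (∀ i → m ∣ t i) → m ∣ sum t
∣-sum {zero}  {m} t m∣t = m ∣0
∣-sum {suc n} {m} t m∣t = ∣m∣n⇒∣m+n (m∣t zero) (∣-sum (tail t) (m∣t ∘ suc))

-- The binomial theorem for commutative semirings uses generic multiples and powers; this lemma and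
-- the next turn them into arithmetic on `ℕ`.
×ₛ≡* : ∀ m x → m ×ₛ x ≡ m * x
×ₛ≡* zero    x = refl
×ₛ≡* (suc m) x = cong (x +_) (×ₛ≡* m x)

^ₛ≡^ : ∀ x n → x ^ₛ n ≡ x ^ n
^ₛ≡^ x zero    = refl
^ₛ≡^ x (suc n) = cong (x *_) (^ₛ≡^ x n)

-- The inductive step of Fermat's little theorem: in the expansion of `(1 + k) ^ p` only the two end
-- terms survive modulo `p`.
suc-^p-mod : Prime p → ∀ k → suc k ^ p ≡ suc (k ^ p) [mod p ]
suc-^p-mod {zero}          pr k = contradiction pr ¬prime[0]
suc-^p-mod {p@(suc p-1)}  pr k =
  subst (_≡ suc (k ^ p) [mod p ]) (sym expansion)
    (mod-+-cong {middle} {0} {p} {suc (k ^ p)} {suc (k ^ p)} (∣⇒≡0[mod] p∣middle) (mod-refl {suc (k ^ p)} {p}))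
  where
  open ≡-Reasoning

  t : Vector ℕ (suc p)
  -- With `1` as first summand, term `i` carries `k ^ (p ∸ i)`: the first term is `k ^ p` and the
  -- last is `1`.
  t = binomialTerm +-*-commutativeSemiring 1 k p

  t≡ : ∀ i → t i ≡ (p C toℕ i) * k ^ (p ∸ toℕ i)
  t≡ i = begin
    t i                                                  ≡⟨ ×ₛ≡* (p C toℕ i) _ ⟩
    (p C toℕ i) * (1 ^ₛ toℕ i * k ^ₛ (p ∸ toℕ i))        ≡⟨ cong ((p C toℕ i) *_) (cong₂ _*_ (trans (^ₛ≡^ 1 (toℕ i)) (^-zeroˡ (toℕ i))) (^ₛ≡^ k (p ∸ toℕ i))) ⟩
    (p C toℕ i) * (1 * k ^ (p ∸ toℕ i))                  ≡⟨ cong ((p C toℕ i) *_) (*-identityˡ _) ⟩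
    (p C toℕ i) * k ^ (p ∸ toℕ i)                        ∎

  middle : ℕ
  middle = sum (init (tail t))

  p∣middle : p ∣ middle
  p∣middle = ∣-sum (init (tail t)) λ i →
    -- Entry `i` of the trimmed vector is term `1 + i` of `t`, and `i < p-1` keeps that index
    -- strictly between `0` and `p`.
    subst (p ∣_) (sym (t≡ (suc (inject₁ i))))
      (∣m⇒∣m*n _ (prime∣pCk pr z<s (s<s (subst (_< p-1) (sym (toℕ-inject₁ i)) (toℕ<n i)))))

  first≡ : t zero ≡ k ^ p
  first≡ = trans (t≡ zero) (*-identityˡ (k ^ p))

  last≡ : last t ≡ 1
  last≡ = begin
    last t                                          ≡⟨ t≡ (fromℕ p) ⟩
    (p C toℕ (fromℕ p)) * k ^ (p ∸ toℕ (fromℕ p))   ≡⟨ cong (λ i → (p C i) * k ^ (p ∸ i)) (toℕ-fromℕ p) ⟩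
    (p C p) * k ^ (p ∸ p)                           ≡⟨ cong₂ (λ i j → i * k ^ j) (nCn≡1 p) (n∸n≡0 p) ⟩
    1                                               ∎

  expansion : suc k ^ p ≡ middle + suc (k ^ p)
  expansion = begin
    suc k ^ p                   ≡⟨ ^ₛ≡^ (suc k) p ⟨
    suc k ^ₛ p                  ≡⟨ theorem +-*-commutativeSemiring p 1 k ⟩
    t zero + sum (tail t)       ≡⟨ cong₂ _+_ first≡ (sum-init-last (tail t)) ⟩
    k ^ p + (middle + last t)   ≡⟨ cong (λ i → k ^ p + (middle + i)) last≡ ⟩
    k ^ p + (middle + 1)        ≡⟨ +-comm (k ^ p) _ ⟩
    middle + 1 + k ^ p          ≡⟨ +-assoc middle 1 (k ^ p) ⟩
    middle + suc (k ^ p)        ∎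

fermat : Prime p → ∀ k → k ^ p ≡ k [mod p ]
fermat {zero}  pr k       = contradiction pr ¬prime[0]
-- `0 ^ suc p` computes to `0`, whereas `0 ^ 0` would be `1`.
fermat {suc p} pr zero    = mod-refl {0} {suc p}
fermat {p}     pr (suc k) =
  mod-trans {suc k ^ p} {suc (k ^ p)} {p} {suc k} (suc-^p-mod pr k)
    (mod-+-cong {1} {1} {p} {k ^ p} {k} (mod-refl {1} {p}) (fermat pr k))

-- Induction on `q`: the congruence for the summands passes to their sum, which the hockey-stick
-- identity evaluates. The indices are written in the shape that identity produces.
hyperSum-mod : Prime p → ∀ q n → hyperSum p q n ≡ (n + suc q) C suc (suc q) [mod p ]
hyperSum-mod {p} pr zero n =
  subst (powerSum p n ≡_[mod p ]) (∑₁-[k+q]C[1+q] 0 n)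
    (∑₁-cong-mod (λ k → subst (k ^ p ≡_[mod p ]) (sym (k+0C1≡k k)) (fermat pr k)) n)
  where
  k+0C1≡k : ∀ k → (k + 0) C 1 ≡ k
  k+0C1≡k k = trans (nC1≡n (k + 0)) (+-identityʳ k)
hyperSum-mod {p} pr (suc q) n =
  subst (hyperSum p (suc q) n ≡_[mod p ]) (∑₁-[k+q]C[1+q] (suc q) n)
    (∑₁-cong-mod (hyperSum-mod pr q) n)

theorem15 : (p : ℕ) → Prime p → (q n : ℕ) → 1 ≤ n →
    hyperSum p q n ≡ (n + q + 1) C (q + 2) [mod p ]
theorem15 p pr q n _ =
  subst₂ (λ i j → hyperSum p q n ≡ i C j [mod p ])
    (trans (cong (_+_ n) (+-comm 1 q)) (sym (+-assoc n q 1))) (+-comm 2 q) (hyperSum-mod pr q n)
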